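{- Let $G_1$ and $G_2$ be two Hamiltonian graphs such that $e_1\in E(G_1)$ and $e_2\in E(G_2)$. The graph $G=G_1(e_1)\#G_2(e_2)$, obtained by a 2-cut connection on $e_1$ and $e_2$, is 2FH if and only if every 2-factor of $G_1$ is a Hamiltonian cycle containing $e_1$ and every 2-factor of $G_2$ containing $e_2$ is a Hamiltonian cycle (or vice-versa, that is, the same condition with the roles of $(G_1,e_1)$ and $(G_2,e_2)$ exchanged).
   Context: Graphs are finite and connected, may have multiple (parallel) edges, and have no loops; $G_1$ and $G_2$ need not be regular. A $2$-factor of a graph is a $2$-regular spanning subgraph (not necessarily connected), and a Hamiltonian cycle is a connected $2$-factor. A graph is Hamiltonian if it has a Hamiltonian cycle. A Hamiltonian graph is 2FH (2-factor Hamiltonian) if each of its $2$-factors is a Hamiltonian cycle. 2-cut connection: let $e_1=x_1y_1\in E(G_1)$ and $e_2=x_2y_2\in E(G_2)$, with $G_1,G_2$ vertex-disjoint. A 2-cut connection on $e_1$ and $e_2$ constructs the graph $(G_1-e_1)\cup(G_2-e_2)\cup\{x_1x_2,y_1y_2\}$; $G_1(e_1)\#G_2(e_2)$ denotes either this graph or the one obtained by swapping the roles of $x_2$ and $y_2$.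
   Formalization: The condition "every 2-factor of G_2 containing e_2 is a Hamiltonian cycle" also requires that some 2-factor of G_2 contains e_2 (likewise G_1, e_1 in the vice-versa case); without this the "if" part fails, e.g. for G_1 a triangle and G_2 a 4-cycle plus a chord e_2. -}

module Defs where

open import Data.Bool using (Bool; true; false; if_then_else_; _∨_)
open import Data.Fin using (Fin; _≟_; _↑ˡ_; _↑ʳ_; splitAt)
open import Data.Fin.Properties using (↑ˡ-injective; ↑ʳ-injective; splitAt-↑ˡ; splitAt-↑ʳ)
open import Data.Fin.Subset using (Subset; _∈_; _∩_; ∣_∣; ⊤)
open import Data.Nat using (ℕ; _+_)
open import Data.Product using (∃; _×_; _,_; proj₁; proj₂; map; swap)
open import Data.Sum using (_⊎_; inj₁; inj₂; [_,_]′)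
open import Data.Vec using (tabulate)
open import Relation.Binary.Construct.Closure.ReflexiveTransitive using (Star)
open import Relation.Binary.PropositionalEquality using (_≡_; _≢_; sym; trans; cong)
open import Relation.Nullary using (does)

-- Finite loopless multigraphs.  Each edge lists its two ends in some order;
-- the order carries no meaning, and distinct edges may have the same ends.
record Graph : Set where
  field
    order    : ℕ
    size     : ℕ
    ends     : Fin size → Fin order × Fin order
    loopless : ∀ e → proj₁ (ends e) ≢ proj₂ (ends e)

  Vertex : Set
  Vertex = Fin order

  Edge : Set
  Edge = Fin size

  -- A spanning subgraph is determined by its set of edges.
  SpanningSubgraph : Set
  SpanningSubgraph = Subset size

  incidentEdges : Vertex → Subset size
  incidentEdges v = tabulate λ e → does (v ≟ proj₁ (ends e)) ∨ does (v ≟ proj₂ (ends e))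

  -- Counting incident edges gives the degree because there are no loops.
  degree : SpanningSubgraph → Vertex → ℕ
  degree F v = ∣ F ∩ incidentEdges v ∣

  Adjacent : SpanningSubgraph → Vertex → Vertex → Set
  Adjacent F u v = ∃ λ e → e ∈ F × (ends e ≡ (u , v) ⊎ ends e ≡ (v , u))

  ConnectedSubgraph : SpanningSubgraph → Set
  ConnectedSubgraph F = ∀ u v → Star (Adjacent F) u v

open Graph public using (Edge; SpanningSubgraph)

Connected : Graph → Set
Connected G = Graph.ConnectedSubgraph G ⊤

TwoFactor : (G : Graph) → SpanningSubgraph G → Set
TwoFactor G F = ∀ v → Graph.degree G F v ≡ 2

HamiltonianCycle : (G : Graph) → SpanningSubgraph G → Set
HamiltonianCycle G F = TwoFactor G F × Graph.ConnectedSubgraph G F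

Hamiltonian : Graph → Set
Hamiltonian G = ∃ λ F → HamiltonianCycle G F

TwoFactorHamiltonian : Graph → Set
TwoFactorHamiltonian G = Hamiltonian G × (∀ F → TwoFactor G F → HamiltonianCycle G F)

-- The graph (G₁ - e₁) ∪ (G₂ - e₂) ∪ {x₁x₂ , y₁y₂}, where e₁ = x₁y₁ and e₂ = x₂y₂
-- with the ends in the listed order, except that x₂ and y₂ are exchanged when
-- `swapped` is true.  The vertex set Fin (n₁ + n₂) is the disjoint union of the
-- two vertex sets.  The edge set Fin (m₁ + m₂) is likewise a disjoint union, in
-- which the index freed by deleting e₁ is reused for the new edge x₁x₂, and the
-- index freed by deleting e₂ for y₁y₂.
twoCutConnection : (G₁ : Graph) → Edge G₁ → (G₂ : Graph) → Edge G₂ → Bool → Graph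
twoCutConnection G₁ e₁ G₂ e₂ swapped = record
  { order    = G₁.order + G₂.order
  ; size     = G₁.size + G₂.size
  ; ends     = λ e → endsOf (splitAt G₁.size e)
  ; loopless = λ e → endsOf-loopless (splitAt G₁.size e)
  }
  where
  module G₁ = Graph G₁
  module G₂ = Graph G₂

  ι₁ : G₁.Vertex → Fin (G₁.order + G₂.order)
  ι₁ v = v ↑ˡ G₂.order

  ι₂ : G₂.Vertex → Fin (G₁.order + G₂.order)
  ι₂ v = G₁.order ↑ʳ v

  x₁ y₁ : G₁.Vertex
  x₁ = proj₁ (G₁.ends e₁)
  y₁ = proj₂ (G₁.ends e₁)

  x₂y₂ : G₂.Vertex × G₂.Vertex
  x₂y₂ = if swapped then swap (G₂.ends e₂) else G₂.ends e₂

  x₂ y₂ : G₂.Vertex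
  x₂ = proj₁ x₂y₂
  y₂ = proj₂ x₂y₂

  endsOf : G₁.Edge ⊎ G₂.Edge → Fin (G₁.order + G₂.order) × Fin (G₁.order + G₂.order)
  endsOf (inj₁ e) = if does (e ≟ e₁) then (ι₁ x₁ , ι₂ x₂) else map ι₁ ι₁ (G₁.ends e)
  endsOf (inj₂ e) = if does (e ≟ e₂) then (ι₁ y₁ , ι₂ y₂) else map ι₂ ι₂ (G₂.ends e)

  ι₁≢ι₂ : ∀ u v → ι₁ u ≢ ι₂ v
  ι₁≢ι₂ u v eq
    with () ← trans (sym (splitAt-↑ˡ G₁.order u G₂.order))
                (trans (cong (splitAt G₁.order) eq) (splitAt-↑ʳ G₁.order G₂.order v))

  endsOf-loopless : ∀ e → proj₁ (endsOf e) ≢ proj₂ (endsOf e)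
  endsOf-loopless (inj₁ e) with does (e ≟ e₁)
  ... | true  = ι₁≢ι₂ x₁ x₂
  ... | false = λ eq → G₁.loopless e (↑ˡ-injective G₂.order _ _ eq)
  endsOf-loopless (inj₂ e) with does (e ≟ e₂)
  ... | true  = ι₁≢ι₂ y₁ y₂
  ... | false = λ eq → G₂.loopless e (↑ʳ-injective G₁.order _ _ eq)

{-# OPTIONS --safe #-}
-- Since the degrees of a 2-factor are even, every cut meets it in an even number
-- of edges.  For the cut between G₁ and G₂ this shows that a 2-factor of G uses
-- both new edges or neither, so it amounts to a pair of 2-factors of G₁ and G₂
-- that agree on containing e₁ and e₂.  The pair is a Hamiltonian cycle of G
-- exactly when both members are Hamiltonian cycles and contain e₁ and e₂.  Hence
-- if G is 2FH, then G₁ and G₂ cannot both have a 2-factor avoiding the chosen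
-- edge, and the two alternatives of the theorem are the two remaining cases.
module Submission where

open import Defs
import Algebra.Properties.Semiring.Sum
open import Data.Bool using (Bool; true; false; if_then_else_; _∨_)
import Data.Bool.Properties as Bool
open import Data.Fin using (Fin; zero; suc; _≟_; _↑ˡ_; _↑ʳ_; splitAt)
open import Data.Fin.Properties
  using (↑ˡ-injective; ↑ʳ-injective; splitAt-↑ˡ; splitAt-↑ʳ; splitAt⁻¹-↑ˡ; splitAt⁻¹-↑ʳ;
         punchInᵢ≢i; any?; all?)
open import Data.Fin.Subset using (Subset; _∈_; _∉_; _∩_; _-_; _⊃_; ∣_∣; ⁅_⁆; ⊤; ⊥)
open import Data.Fin.Subset.Induction using (Acc; acc; ⊃-wellFounded)
open import Data.Fin.Subset.Properties
  using (_∈?_; anySubset?; x∈⁅x⁆; x∈⁅y⁆⇒x≡y; x∈p∪q⁺; x∈p∪q⁻; p⊆p∪q; p─q⊆p; x∈p∧x≢y⇒x∈p-y)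
open import Data.Nat using (ℕ; zero; suc; _+_; _*_)
import Data.Nat as ℕ
open import Data.Nat.Divisibility using (_∣_; _∣?_; _∣0; ∣m∣n⇒∣m+n; ∣m+n∣m⇒∣n; ∣n⇒∣m*n; ∣-refl)
open import Data.Nat.Properties
  using (+-*-semiring; +-assoc; +-comm; +-identityʳ; *-comm; *-assoc; *-zeroʳ; *-distribˡ-+; *-identityʳ)
open import Data.Product using (∃; _×_; _,_; proj₁; proj₂; map; swap)
open import Data.Sum using (_⊎_; inj₁; inj₂; [_,_]′)
open import Data.Vec using ([]; _∷_; _++_; lookup; tabulate; take; drop; there)
open import Data.Vec.Functional using (removeAt)
open import Data.Vec.Properties
  using (lookup-++ˡ; lookup-++ʳ; lookup-replicate; take++drop≡id; []=⇒lookup; lookup⇒[]=)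
open import Function using (_∘_; id; const)
open import Function.Bundles using (_⇔_; mk⇔; Equivalence)
open import Relation.Binary.Construct.Closure.ReflexiveTransitive using (Star; ε; _◅_; _◅◅_; fold; kleisliStar; reverse)
open import Relation.Binary.PropositionalEquality
  using (_≡_; _≢_; refl; sym; trans; cong; cong₂; subst; subst₂; module ≡-Reasoning)
open import Relation.Nullary using (yes; no; does; ¬_; contradiction)
open import Relation.Nullary.Decidable using (¬?; _×-dec_; dec-true; dec-false; does-⇔; decidable-stable; from-no)

open Algebra.Properties.Semiring.Sum +-*-semiring
  using (sum; sum-cong-≗; sum-remove; ∑-comm; ∑-distrib-+; *-distribˡ-sum)
open Graph using (order; size; ends; degree; Adjacent)

-- Finite sums: divisibility and isolating one index.

∣-sum : ∀ {n d} (f : Fin n → ℕ) → (∀ i → d ∣ f i) → d ∣ sum f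
∣-sum {zero}  f d∣f = _ ∣0
∣-sum {suc n} f d∣f = ∣m∣n⇒∣m+n (d∣f zero) (∣-sum (f ∘ suc) (d∣f ∘ suc))

∣-sum⇒∣-summand : ∀ {n d} (f : Fin n → ℕ) i → (∀ j → j ≢ i → d ∣ f j) → d ∣ sum f → d ∣ f i
∣-sum⇒∣-summand {suc n} {d} f i d∣others d∣sum =
  ∣m+n∣m⇒∣n
    (subst (d ∣_) (trans (sum-remove {i = i} f) (+-comm (f i) _)) d∣sum)
    (∣-sum _ λ j → d∣others _ (punchInᵢ≢i i j))

-- Serves the degree count across the cut: `i` is the deleted edge and `c` the share of its
-- contribution that is counted at the other new edge.
sum-cong-except : ∀ {n} (f g : Fin n → ℕ) i → (∀ j → j ≢ i → f j ≡ g j) → ∀ {c} →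
                  f i ≡ g i + c → sum f ≡ sum g + c
sum-cong-except {suc n} f g i f≗g {c} fi = begin
  sum f                   ≡⟨ sum-remove {i = i} f ⟩
  f i + rest f            ≡⟨ cong₂ _+_ fi (sum-cong-≗ λ j → f≗g _ (punchInᵢ≢i i j)) ⟩
  g i + c + rest g        ≡⟨ +-assoc (g i) c _ ⟩
  g i + (c + rest g)      ≡⟨ cong (g i +_) (+-comm c _) ⟩
  g i + (rest g + c)      ≡⟨ +-assoc (g i) _ c ⟨
  g i + rest g + c        ≡⟨ cong (_+ c) (sum-remove {i = i} g) ⟨
  sum g + c               ∎
  where
  open ≡-Reasoning
  rest : (Fin (suc n) → ℕ) → ℕ
  rest h = sum (removeAt h i)

sum-zero : ∀ n → sum {n} (const 0) ≡ 0
sum-zero zero    = refl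
sum-zero (suc n) = sum-zero n

sum-single : ∀ {n} (f : Fin n → ℕ) i → (∀ j → j ≢ i → f j ≡ 0) → sum f ≡ f i
sum-single {n} f i f≗0 = trans (sum-cong-except f (const 0) i f≗0 refl) (cong (_+ f i) (sum-zero n))

sum-splitAt : ∀ m {n} (f : Fin (m + n) → ℕ) → sum f ≡ sum (f ∘ (_↑ˡ n)) + sum (f ∘ (m ↑ʳ_))
sum-splitAt zero    f = refl
sum-splitAt (suc m) f = trans (cong (f zero +_) (sum-splitAt m (f ∘ suc))) (sym (+-assoc (f zero) _ _))

-- Indicators and incidence counts.

⟦_⟧ : Bool → ℕ
⟦ b ⟧ = if b then 1 else 0

δ : ∀ {n} → Fin n → Fin n → ℕ
δ u v = ⟦ does (u ≟ v) ⟧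

δ-refl : ∀ {n} (u : Fin n) → δ u u ≡ 1
δ-refl u = cong ⟦_⟧ (dec-true (u ≟ u) refl)

δ-≢ : ∀ {n} {u v : Fin n} → u ≢ v → δ u v ≡ 0
δ-≢ {u = u} {v} u≢v = cong ⟦_⟧ (dec-false (u ≟ v) u≢v)

δ-injective : ∀ {m n} (f : Fin m → Fin n) → (∀ {u v} → f u ≡ f v → u ≡ v) → ∀ u v → δ (f u) (f v) ≡ δ u v
δ-injective f inj u v = cong ⟦_⟧ (does-⇔ (mk⇔ inj (cong f)) (f u ≟ f v) (u ≟ v))

sum-δ : ∀ {n} (f : Fin n → ℕ) p → sum (λ v → f v * δ v p) ≡ f p
sum-δ f p = begin
  sum (λ v → f v * δ v p)  ≡⟨ sum-single _ p (λ v v≢p → trans (cong (f v *_) (δ-≢ v≢p)) (*-zeroʳ (f v))) ⟩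
  f p * δ p p              ≡⟨ cong (f p *_) (δ-refl p) ⟩
  f p * 1                  ≡⟨ *-identityʳ (f p) ⟩
  f p                      ∎
  where open ≡-Reasoning

endCount : ∀ {n} → Fin n → Fin n × Fin n → ℕ
endCount v (p , q) = δ v p + δ v q

∣∩tabulate∣ : ∀ {n} (F : Subset n) (g : Fin n → Bool) → ∣ F ∩ tabulate g ∣ ≡ sum (λ i → ⟦ lookup F i ⟧ * ⟦ g i ⟧)
∣∩tabulate∣ []          g = refl
∣∩tabulate∣ (false ∷ F) g = ∣∩tabulate∣ F (g ∘ suc)
∣∩tabulate∣ (true ∷ F)  g with g zero
... | true  = cong suc (∣∩tabulate∣ F (g ∘ suc))
... | false = ∣∩tabulate∣ F (g ∘ suc)

∉⇒lookup : ∀ {n} {S : Subset n} {v} → v ∉ S → lookup S v ≡ false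
∉⇒lookup v∉S = Bool.¬-not (v∉S ∘ lookup⇒[]= _ _)

-- Double counting and parity of edge cuts.

module _ (G : Graph) where

  -- Incidence is a disjunction over the two ends; as there are no loops, at most one disjunct
  -- holds, so it equals the sum `endCount`. This makes degrees linear in the ends.
  degree-sum : ∀ F v → degree G F v ≡ sum (λ e → ⟦ lookup F e ⟧ * endCount v (ends G e))
  degree-sum F v = trans (∣∩tabulate∣ F _) (sum-cong-≗ λ e → cong (⟦ lookup F e ⟧ *_) (incidence e))
    where
    incidence : ∀ e → ⟦ does (v ≟ proj₁ (ends G e)) ∨ does (v ≟ proj₂ (ends G e)) ⟧ ≡ endCount v (ends G e)
    incidence e with v ≟ proj₁ (ends G e) | v ≟ proj₂ (ends G e)
    ... | yes v≡p | yes v≡q = contradiction (trans (sym v≡p) v≡q) (Graph.loopless G e)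
    ... | yes _   | no  _   = refl
    ... | no  _   | yes _   = refl
    ... | no  _   | no  _   = refl

  Crosses : Subset (order G) → Edge G → Set
  Crosses S e = lookup S (proj₁ (ends G e)) ≢ lookup S (proj₂ (ends G e))

  endsInside : Subset (order G) → Edge G → ℕ
  endsInside S e = ⟦ lookup S (proj₁ (ends G e)) ⟧ + ⟦ lookup S (proj₂ (ends G e)) ⟧

  -- Both sides count the incidences between vertices of `S` and edges of `F`; the proof exchanges
  -- the two sums and evaluates the inner one with `sum-δ`.
  handshake : ∀ F S → sum (λ v → ⟦ lookup S v ⟧ * degree G F v) ≡ sum (λ e → ⟦ lookup F e ⟧ * endsInside S e)
  handshake F S = begin
    sum (λ v → s v * degree G F v)
      ≡⟨ sum-cong-≗ (λ v → trans (cong (s v *_) (degree-sum F v)) (*-distribˡ-sum (s v) (λ e → f e * c v e))) ⟩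
    sum (λ v → sum (λ e → s v * (f e * c v e)))
      ≡⟨ ∑-comm (λ v e → s v * (f e * c v e)) ⟩
    sum (λ e → sum (λ v → s v * (f e * c v e)))
      ≡⟨ sum-cong-≗ edge ⟩
    sum (λ e → f e * endsInside S e) ∎
    where
    open ≡-Reasoning
    s : Fin (order G) → ℕ
    s v = ⟦ lookup S v ⟧
    f : Edge G → ℕ
    f e = ⟦ lookup F e ⟧
    c : Fin (order G) → Edge G → ℕ
    c v e = endCount v (ends G e)
    commute : ∀ a b d → a * (b * d) ≡ b * (a * d)
    commute a b d = trans (sym (*-assoc a b d)) (trans (cong (_* d) (*-comm a b)) (*-assoc b a d))
    edge : ∀ e → sum (λ v → s v * (f e * c v e)) ≡ f e * endsInside S e
    edge e = let p , q = ends G e in begin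
      sum (λ v → s v * (f e * c v e))
        ≡⟨ sum-cong-≗ (λ v → commute (s v) (f e) (c v e)) ⟩
      sum (λ v → f e * (s v * c v e))
        ≡⟨ *-distribˡ-sum (f e) (λ v → s v * c v e) ⟨
      f e * sum (λ v → s v * c v e)
        ≡⟨ cong (f e *_) (sum-cong-≗ (λ v → *-distribˡ-+ (s v) (δ v p) (δ v q))) ⟩
      f e * sum (λ v → s v * δ v p + s v * δ v q)
        ≡⟨ cong (f e *_) (∑-distrib-+ (λ v → s v * δ v p) (λ v → s v * δ v q)) ⟩
      f e * (sum (λ v → s v * δ v p) + sum (λ v → s v * δ v q))
        ≡⟨ cong (f e *_) (cong₂ _+_ (sum-δ s p) (sum-δ s q)) ⟩
      f e * endsInside S e ∎

  -- In `handshake` the vertex side is even because all degrees are 2. On the edge side a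
  -- non-crossing edge contributes 0 or 2, while `e` contributes 1, so `e` cannot be the only
  -- crossing edge of `F`. Searching the finite edge set produces the second one.
  another-crossing : ∀ {F} → TwoFactor G F → ∀ S {e} → e ∈ F → Crosses S e →
                     ∃ λ e′ → e′ ≢ e × e′ ∈ F × Crosses S e′
  another-crossing {F} tf S {e} e∈F cross
    with any? (λ e′ → ¬? (e′ ≟ e) ×-dec (e′ ∈? F) ×-dec ¬? (_ Bool.≟ _))
  ... | yes found = found
  ... | no  none  = contradiction (subst (2 ∣_) odd 2∣e) (from-no (2 ∣? 1))
    where
    even-sum : 2 ∣ sum (λ e′ → ⟦ lookup F e′ ⟧ * endsInside S e′)
    even-sum = subst (2 ∣_) (handshake F S) (∣-sum _ λ v → ∣n⇒∣m*n ⟦ lookup S v ⟧ (subst (2 ∣_) (sym (tf v)) ∣-refl))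
    even-other : ∀ e′ → e′ ≢ e → 2 ∣ ⟦ lookup F e′ ⟧ * endsInside S e′
    even-other e′ e′≢e with lookup F e′ in e′∈F
    ... | false = 2 ∣0
    ... | true  = ∣n⇒∣m*n 1 (even (decidable-stable (_ Bool.≟ _) λ cr → none (e′ , e′≢e , lookup⇒[]= e′ F e′∈F , cr)))
      where
      even : ∀ {a b} → a ≡ b → 2 ∣ ⟦ a ⟧ + ⟦ b ⟧
      even {true}  refl = ∣-refl
      even {false} refl = 2 ∣0
    2∣e : 2 ∣ ⟦ lookup F e ⟧ * endsInside S e
    2∣e = ∣-sum⇒∣-summand _ e even-other even-sum
    odd : ⟦ lookup F e ⟧ * endsInside S e ≡ 1
    odd rewrite []=⇒lookup e∈F with lookup S (proj₁ (ends G e)) | lookup S (proj₂ (ends G e))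
    ... | true  | true  = contradiction refl cross
    ... | true  | false = refl
    ... | false | true  = refl
    ... | false | false = contradiction refl cross

  -- Walks, and connectivity after deleting an edge of a 2-factor.

  Adjacent-sym : ∀ {F u v} → Adjacent G F u v → Adjacent G F v u
  Adjacent-sym (e , e∈F , inj₁ eq) = e , e∈F , inj₂ eq
  Adjacent-sym (e , e∈F , inj₂ eq) = e , e∈F , inj₁ eq

  Reachable : SpanningSubgraph G → Fin (order G) → Fin (order G) → Set
  Reachable F = Star (Adjacent G F)

  Reachable-sym : ∀ {F u v} → Reachable F u v → Reachable F v u
  Reachable-sym = reverse Adjacent-sym

  edge-reachable : ∀ {F e u v} → e ∈ F → ends G e ≡ (u , v) → Reachable F u v
  edge-reachable e∈F eq = (_ , e∈F , inj₁ eq) ◅ ε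

  another-exit : ∀ {F} → TwoFactor G F → ∀ S {e} → e ∈ F → Crosses S e →
                 ∃ λ u → ∃ λ v → u ∈ S × v ∉ S × Adjacent G (F - e) u v
  another-exit {F} tf S e∈F cross with another-crossing {F} tf S e∈F cross
  ... | e′ , e′≢e , e′∈F , cross′ with proj₁ (ends G e′) ∈? S | proj₂ (ends G e′) ∈? S
  ... | yes u∈S | no  v∉S = _ , _ , u∈S , v∉S , e′ , x∈p∧x≢y⇒x∈p-y e′∈F e′≢e , inj₁ refl
  ... | no  u∉S | yes v∈S = _ , _ , v∈S , u∉S , e′ , x∈p∧x≢y⇒x∈p-y e′∈F e′≢e , inj₂ refl
  ... | yes u∈S | yes v∈S = contradiction (trans ([]=⇒lookup u∈S) (sym ([]=⇒lookup v∈S))) cross′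
  ... | no  u∉S | no  v∉S = contradiction (trans (∉⇒lookup u∉S) (sym (∉⇒lookup v∉S))) cross′

  -- Grow the set of vertices reachable without e: as long as it misses the other
  -- end of e, it is crossed by e and hence by another edge of F.
  reachable-without : ∀ {F} → TwoFactor G F → ∀ {e} → e ∈ F →
                      Reachable (F - e) (proj₁ (ends G e)) (proj₂ (ends G e))
  reachable-without {F} tf {e} e∈F =
    grow (⊃-wellFounded ⁅ p ⁆) (x∈⁅x⁆ p) λ v∈ → subst (Reachable (F - e) p) (sym (x∈⁅y⁆⇒x≡y p v∈)) ε
    where
    p = proj₁ (ends G e)
    q = proj₂ (ends G e)
    grow : ∀ {S} → Acc _⊃_ S → p ∈ S → (∀ {v} → v ∈ S → Reachable (F - e) p v) → Reachable (F - e) p q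
    grow {S} (acc rec) p∈S reach with q ∈? S
    ... | yes q∈S = reach q∈S
    ... | no  q∉S
      with u , v , u∈S , v∉S , uv ← another-exit {F} tf S e∈F
             (λ eq → q∉S (lookup⇒[]= q S (trans (sym eq) ([]=⇒lookup p∈S)))) =
      grow (rec (p⊆p∪q ⁅ v ⁆ , v , x∈p∪q⁺ (inj₂ (x∈⁅x⁆ v)) , v∉S)) (x∈p∪q⁺ (inj₁ p∈S))
        λ w∈ → [ reach , (λ w∈v → subst (Reachable (F - e) p) (sym (x∈⁅y⁆⇒x≡y v w∈v)) (reach u∈S ◅◅ uv ◅ ε)) ]′
                 (x∈p∪q⁻ S ⁅ v ⁆ w∈)

x∉p-x : ∀ {n} (p : Subset n) {x} → x ∉ p - x
x∉p-x (_ ∷ p) {zero}  ()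
x∉p-x (_ ∷ p) {suc x} (there x∈) = x∉p-x p x∈

-- An edge may go to a walk, possibly trivial, which covers both contraction and rerouting. Only the
-- listed order of ends has to be checked, since reachability is symmetric.
Reachable-map : ∀ G H {F F′} (φ : Fin (order G) → Fin (order H)) →
                (∀ {e} → e ∈ F → Reachable H F′ (φ (proj₁ (ends G e))) (φ (proj₂ (ends G e)))) →
                ∀ {u v} → Reachable G F u v → Reachable H F′ (φ u) (φ v)
Reachable-map G H {F} {F′} φ edge = kleisliStar φ step
  where
  step : ∀ {u v} → Adjacent G F u v → Reachable H F′ (φ u) (φ v)
  step (e , e∈F , inj₁ eq) rewrite sym (cong proj₁ eq) | sym (cong proj₂ eq) = edge e∈F
  step (e , e∈F , inj₂ eq) rewrite sym (cong proj₁ eq) | sym (cong proj₂ eq) = Reachable-sym H (edge e∈F)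

-- Confines the case distinction on `swapped` to properties checked for both orders of the ends of
-- `e₂`.
if-swap : ∀ {A : Set} (P : A × A → Set) b {p} → P p → P (swap p) → P (if b then swap p else p)
if-swap P true  _ Pswap = Pswap
if-swap P false Pp _    = Pp

HasCycleThrough : (G : Graph) → Edge G → SpanningSubgraph G → Set
HasCycleThrough G e F = HamiltonianCycle G F × e ∈ F

-- Edges, vertices and the cut of the connection.

module TwoCut (G₁ : Graph) (e₁ : Edge G₁) (G₂ : Graph) (e₂ : Edge G₂) (swapped : Bool) where

  G : Graph
  G = twoCutConnection G₁ e₁ G₂ e₂ swapped

  private
    n₁ = order G₁
    n₂ = order G₂
    m₁ = size G₁
    m₂ = size G₂

  ι₁ : Fin n₁ → Fin (n₁ + n₂)
  ι₁ v = v ↑ˡ n₂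

  ι₂ : Fin n₂ → Fin (n₁ + n₂)
  ι₂ v = n₁ ↑ʳ v

  x₁ y₁ : Fin n₁
  x₁ = proj₁ (ends G₁ e₁)
  y₁ = proj₂ (ends G₁ e₁)

  x₂y₂ : Fin n₂ × Fin n₂
  x₂y₂ = if swapped then swap (ends G₂ e₂) else ends G₂ e₂

  x₂ y₂ : Fin n₂
  x₂ = proj₁ x₂y₂
  y₂ = proj₂ x₂y₂

  ends-inner₁ : ∀ {e} → e ≢ e₁ → ends G (e ↑ˡ m₂) ≡ map ι₁ ι₁ (ends G₁ e)
  ends-inner₁ {e} e≢e₁ rewrite splitAt-↑ˡ m₁ e m₂ | dec-false (e ≟ e₁) e≢e₁ = refl

  ends-inner₂ : ∀ {e} → e ≢ e₂ → ends G (m₁ ↑ʳ e) ≡ map ι₂ ι₂ (ends G₂ e)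
  ends-inner₂ {e} e≢e₂ rewrite splitAt-↑ʳ m₁ m₂ e | dec-false (e ≟ e₂) e≢e₂ = refl

  ends-new₁ : ends G (e₁ ↑ˡ m₂) ≡ (ι₁ x₁ , ι₂ x₂)
  ends-new₁ rewrite splitAt-↑ˡ m₁ e₁ m₂ | dec-true (e₁ ≟ e₁) refl = refl

  ends-new₂ : ends G (m₁ ↑ʳ e₂) ≡ (ι₁ y₁ , ι₂ y₂)
  ends-new₂ rewrite splitAt-↑ʳ m₁ m₂ e₂ | dec-true (e₂ ≟ e₂) refl = refl

  data EdgeView : Edge G → Set where
    inner₁ : ∀ e → e ≢ e₁ → EdgeView (e ↑ˡ m₂)
    inner₂ : ∀ e → e ≢ e₂ → EdgeView (m₁ ↑ʳ e)
    new₁   : EdgeView (e₁ ↑ˡ m₂)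
    new₂   : EdgeView (m₁ ↑ʳ e₂)

  edgeView : ∀ e → EdgeView e
  edgeView e with splitAt m₁ e in eq
  edgeView e | inj₁ e′ rewrite sym (splitAt⁻¹-↑ˡ eq) with e′ ≟ e₁
  ... | yes refl = new₁
  ... | no  ne   = inner₁ e′ ne
  edgeView e | inj₂ e′ rewrite sym (splitAt⁻¹-↑ʳ eq) with e′ ≟ e₂
  ... | yes refl = new₂
  ... | no  ne   = inner₂ e′ ne

  data VertexView : Fin (n₁ + n₂) → Set where
    from₁ : ∀ v → VertexView (ι₁ v)
    from₂ : ∀ v → VertexView (ι₂ v)

  vertexView : ∀ v → VertexView v
  vertexView v with splitAt n₁ v in eq
  ... | inj₁ v′ = subst VertexView (splitAt⁻¹-↑ˡ eq) (from₁ v′)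
  ... | inj₂ v′ = subst VertexView (splitAt⁻¹-↑ʳ eq) (from₂ v′)

  ι₁≢ι₂ : ∀ u v → ι₁ u ≢ ι₂ v
  ι₁≢ι₂ u v eq
    with () ← trans (sym (splitAt-↑ˡ n₁ u n₂)) (trans (cong (splitAt n₁) eq) (splitAt-↑ʳ n₁ n₂ v))

  side₁ : Subset (n₁ + n₂)
  side₁ = ⊤ {n₁} ++ ⊥ {n₂}

  side₁-ι₁ : ∀ v → lookup side₁ (ι₁ v) ≡ true
  side₁-ι₁ v = trans (lookup-++ˡ ⊤ ⊥ v) (lookup-replicate v true)

  side₁-ι₂ : ∀ v → lookup side₁ (ι₂ v) ≡ false
  side₁-ι₂ v = trans (lookup-++ʳ (⊤ {n₁}) ⊥ v) (lookup-replicate v false)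

  crosses : ∀ {e u v} → ends G e ≡ (ι₁ u , ι₂ v) → Crosses G side₁ e
  crosses {u = u} {v} eq same rewrite eq
    with () ← trans (sym (side₁-ι₁ u)) (trans same (side₁-ι₂ v))

  crossing-edges : ∀ e → Crosses G side₁ e → e ≡ e₁ ↑ˡ m₂ ⊎ e ≡ m₁ ↑ʳ e₂
  crossing-edges e cross with edgeView e
  ... | new₁ = inj₁ refl
  ... | new₂ = inj₂ refl
  ... | inner₁ e′ ne rewrite ends-inner₁ ne = contradiction (trans (side₁-ι₁ _) (sym (side₁-ι₁ _))) cross
  ... | inner₂ e′ ne rewrite ends-inner₂ ne = contradiction (trans (side₁-ι₂ _) (sym (side₁-ι₂ _))) cross

  reachable-x₂y₂ : ∀ {F} → Reachable G₂ F (proj₁ (ends G₂ e₂)) (proj₂ (ends G₂ e₂)) → Reachable G₂ F x₂ y₂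
  reachable-x₂y₂ {F} r = if-swap (λ (x , y) → Reachable G₂ F x y) swapped r (Reachable-sym G₂ r)

  -- Spanning subgraphs of the connection as pairs.

  module _ (F₁ : SpanningSubgraph G₁) (F₂ : SpanningSubgraph G₂) where

    ∈-++ˡ⁺ : ∀ {e} → e ∈ F₁ → e ↑ˡ m₂ ∈ F₁ ++ F₂
    ∈-++ˡ⁺ e∈ = lookup⇒[]= _ _ (trans (lookup-++ˡ F₁ F₂ _) ([]=⇒lookup e∈))

    ∈-++ʳ⁺ : ∀ {e} → e ∈ F₂ → m₁ ↑ʳ e ∈ F₁ ++ F₂
    ∈-++ʳ⁺ e∈ = lookup⇒[]= _ _ (trans (lookup-++ʳ F₁ F₂ _) ([]=⇒lookup e∈))

    ∈-++ˡ⁻ : ∀ {e} → e ↑ˡ m₂ ∈ F₁ ++ F₂ → e ∈ F₁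
    ∈-++ˡ⁻ e∈ = lookup⇒[]= _ _ (trans (sym (lookup-++ˡ F₁ F₂ _)) ([]=⇒lookup e∈))

    ∈-++ʳ⁻ : ∀ {e} → m₁ ↑ʳ e ∈ F₁ ++ F₂ → e ∈ F₂
    ∈-++ʳ⁻ e∈ = lookup⇒[]= _ _ (trans (sym (lookup-++ʳ F₁ F₂ _)) ([]=⇒lookup e∈))

    -- Because edge indices are reused, `e₁ ∈ F₁` records that the pair contains the new edge at
    -- `x₁`, and `e₂ ∈ F₂` the one at `y₁`. Only these two edges cross `side₁`, so by
    -- `another-crossing` each forces the other.
    twoFactor⇒agree : TwoFactor G (F₁ ++ F₂) → lookup F₁ e₁ ≡ lookup F₂ e₂
    twoFactor⇒agree tf = Bool.⇔→≡ (mk⇔ to from)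
      where
      to : lookup F₁ e₁ ≡ true → lookup F₂ e₂ ≡ true
      to e₁∈ with e , e≢ , e∈ , cross ← another-crossing G {F₁ ++ F₂} tf side₁ (∈-++ˡ⁺ (lookup⇒[]= e₁ F₁ e₁∈)) (crosses ends-new₁)
             with crossing-edges e cross
      ... | inj₁ e≡   = contradiction e≡ e≢
      ... | inj₂ refl = []=⇒lookup (∈-++ʳ⁻ e∈)
      from : lookup F₂ e₂ ≡ true → lookup F₁ e₁ ≡ true
      from e₂∈ with e , e≢ , e∈ , cross ← another-crossing G {F₁ ++ F₂} tf side₁ (∈-++ʳ⁺ (lookup⇒[]= e₂ F₂ e₂∈)) (crosses ends-new₂)
               with crossing-edges e cross
      ... | inj₁ refl = []=⇒lookup (∈-++ˡ⁻ e∈)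
      ... | inj₂ e≡   = contradiction e≡ e≢

    -- If `e₁` is missing, agreement rules out both crossing edges, so membership in `side₁` is
    -- constant along walks. A walk from `x₁` to `x₂` contradicts this.
    connected⇒cut-edge∈ : Graph.ConnectedSubgraph G (F₁ ++ F₂) → lookup F₁ e₁ ≡ lookup F₂ e₂ → e₁ ∈ F₁
    connected⇒cut-edge∈ conn agree with e₁ ∈? F₁
    ... | yes e₁∈ = e₁∈
    ... | no  e₁∉ =
      contradiction (trans (sym (side₁-ι₁ x₁)) (trans (same-side (conn (ι₁ x₁) (ι₂ x₂))) (side₁-ι₂ x₂))) λ ()
      where
      uncrossed : ∀ {e} → e ∈ F₁ ++ F₂ → ¬ Crosses G side₁ e
      uncrossed e∈ cross with crossing-edges _ cross
      ... | inj₁ refl = e₁∉ (∈-++ˡ⁻ e∈)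
      ... | inj₂ refl = e₁∉ (lookup⇒[]= e₁ F₁ (trans agree ([]=⇒lookup (∈-++ʳ⁻ e∈))))
      ends-same : ∀ {e} → e ∈ F₁ ++ F₂ → lookup side₁ (proj₁ (ends G e)) ≡ lookup side₁ (proj₂ (ends G e))
      ends-same e∈ = decidable-stable (_ Bool.≟ _) (uncrossed e∈)
      step : ∀ {u v} → Adjacent G (F₁ ++ F₂) u v → lookup side₁ u ≡ lookup side₁ v
      step (e , e∈ , inj₁ eq) = subst (λ (u , v) → lookup side₁ u ≡ lookup side₁ v) eq (ends-same e∈)
      step (e , e∈ , inj₂ eq) = sym (subst (λ (u , v) → lookup side₁ u ≡ lookup side₁ v) eq (ends-same e∈))
      same-side : ∀ {u v} → Reachable G (F₁ ++ F₂) u v → lookup side₁ u ≡ lookup side₁ v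
      same-side = fold (λ u v → lookup side₁ u ≡ lookup side₁ v) (trans ∘ step) refl

    -- Contracting the other graph to a single end of the removed edge maps
    -- both new edges to walks, one of them trivial.
    connected₁ : Graph.ConnectedSubgraph G (F₁ ++ F₂) → e₁ ∈ F₁ → Graph.ConnectedSubgraph G₁ F₁
    connected₁ conn e₁∈ u v =
      subst₂ (Reachable G₁ F₁) (π-ι₁ u) (π-ι₁ v) (Reachable-map G G₁ π edge (conn (ι₁ u) (ι₁ v)))
      where
      π : Fin (n₁ + n₂) → Fin n₁
      π w = [ id , const x₁ ]′ (splitAt n₁ w)
      π-ι₁ : ∀ w → π (ι₁ w) ≡ w
      π-ι₁ w = cong [ id , const x₁ ]′ (splitAt-↑ˡ n₁ w n₂)
      π-ι₂ : ∀ w → π (ι₂ w) ≡ x₁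
      π-ι₂ w = cong [ id , const x₁ ]′ (splitAt-↑ʳ n₁ n₂ w)
      edge : ∀ {e} → e ∈ F₁ ++ F₂ → Reachable G₁ F₁ (π (proj₁ (ends G e))) (π (proj₂ (ends G e)))
      edge {e} e∈ with edgeView e
      ... | inner₁ e′ ne rewrite ends-inner₁ ne | π-ι₁ (proj₁ (ends G₁ e′)) | π-ι₁ (proj₂ (ends G₁ e′)) =
        edge-reachable G₁ (∈-++ˡ⁻ e∈) refl
      ... | inner₂ e′ ne rewrite ends-inner₂ ne | π-ι₂ (proj₁ (ends G₂ e′)) | π-ι₂ (proj₂ (ends G₂ e′)) = ε
      ... | new₁ rewrite ends-new₁ | π-ι₁ x₁ | π-ι₂ x₂ = ε
      ... | new₂ rewrite ends-new₂ | π-ι₁ y₁ | π-ι₂ y₂ = Reachable-sym G₁ (edge-reachable G₁ e₁∈ refl)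

    connected₂ : Graph.ConnectedSubgraph G (F₁ ++ F₂) → e₂ ∈ F₂ → Graph.ConnectedSubgraph G₂ F₂
    connected₂ conn e₂∈ u v =
      subst₂ (Reachable G₂ F₂) (π-ι₂ u) (π-ι₂ v) (Reachable-map G G₂ π edge (conn (ι₂ u) (ι₂ v)))
      where
      π : Fin (n₁ + n₂) → Fin n₂
      π w = [ const x₂ , id ]′ (splitAt n₁ w)
      π-ι₁ : ∀ w → π (ι₁ w) ≡ x₂
      π-ι₁ w = cong [ const x₂ , id ]′ (splitAt-↑ˡ n₁ w n₂)
      π-ι₂ : ∀ w → π (ι₂ w) ≡ w
      π-ι₂ w = cong [ const x₂ , id ]′ (splitAt-↑ʳ n₁ n₂ w)
      edge : ∀ {e} → e ∈ F₁ ++ F₂ → Reachable G₂ F₂ (π (proj₁ (ends G e))) (π (proj₂ (ends G e)))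
      edge {e} e∈ with edgeView e
      ... | inner₁ e′ ne rewrite ends-inner₁ ne | π-ι₁ (proj₁ (ends G₁ e′)) | π-ι₁ (proj₂ (ends G₁ e′)) = ε
      ... | inner₂ e′ ne rewrite ends-inner₂ ne | π-ι₂ (proj₁ (ends G₂ e′)) | π-ι₂ (proj₂ (ends G₂ e′)) =
        edge-reachable G₂ (∈-++ʳ⁻ e∈) refl
      ... | new₁ rewrite ends-new₁ | π-ι₁ x₁ | π-ι₂ x₂ = ε
      -- The contracted edge runs from `x₂` to `y₂`, the ends of `e₂` in an order that depends on
      -- `swapped`.
      ... | new₂ rewrite ends-new₂ | π-ι₁ y₁ | π-ι₂ y₂ = reachable-x₂y₂ (edge-reachable G₂ e₂∈ refl)

    -- A walk through e₁ is rerouted along the two new edges and F₂ - e₂.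
    connected : HasCycleThrough G₁ e₁ F₁ → HasCycleThrough G₂ e₂ F₂ → Graph.ConnectedSubgraph G (F₁ ++ F₂)
    connected ((tf₁ , conn₁) , e₁∈) ((tf₂ , conn₂) , e₂∈) u v = Reachable-sym G (from-x₁ u) ◅◅ from-x₁ v
      where
      R : Fin (n₁ + n₂) → Fin (n₁ + n₂) → Set
      R = Reachable G (F₁ ++ F₂)
      inner₂-reachable : ∀ {e} → e ∈ F₂ → e ≢ e₂ → R (ι₂ (proj₁ (ends G₂ e))) (ι₂ (proj₂ (ends G₂ e)))
      inner₂-reachable e∈ ne = edge-reachable G (∈-++ʳ⁺ e∈) (ends-inner₂ ne)
      e₂-ends : R (ι₂ (proj₁ (ends G₂ e₂))) (ι₂ (proj₂ (ends G₂ e₂)))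
      e₂-ends = Reachable-map G₂ G ι₂
        (λ e∈ → inner₂-reachable (p─q⊆p F₂ ⁅ e₂ ⁆ e∈) (∈-⇒≢ e∈))
        (reachable-without G₂ {F₂} tf₂ e₂∈)
        where
        ∈-⇒≢ : ∀ {e} → e ∈ F₂ - e₂ → e ≢ e₂
        ∈-⇒≢ e∈ refl = x∉p-x F₂ e∈
      lift₂ : ∀ {a b} → Reachable G₂ F₂ a b → R (ι₂ a) (ι₂ b)
      lift₂ = Reachable-map G₂ G ι₂ edge
        where
        edge : ∀ {e} → e ∈ F₂ → R (ι₂ (proj₁ (ends G₂ e))) (ι₂ (proj₂ (ends G₂ e)))
        edge {e} e∈ with e ≟ e₂
        ... | yes refl = e₂-ends
        ... | no  ne   = inner₂-reachable e∈ ne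
      x₁x₂ : R (ι₁ x₁) (ι₂ x₂)
      x₁x₂ = edge-reachable G (∈-++ˡ⁺ e₁∈) ends-new₁
      y₁y₂ : R (ι₁ y₁) (ι₂ y₂)
      y₁y₂ = edge-reachable G (∈-++ʳ⁺ e₂∈) ends-new₂
      lift₁ : ∀ {a b} → Reachable G₁ F₁ a b → R (ι₁ a) (ι₁ b)
      lift₁ = Reachable-map G₁ G ι₁ edge
        where
        edge : ∀ {e} → e ∈ F₁ → R (ι₁ (proj₁ (ends G₁ e))) (ι₁ (proj₂ (ends G₁ e)))
        edge {e} e∈ with e ≟ e₁
        -- The walk from `x₂` to `y₂` may itself use `e₂`. There is no circularity: `lift₂` replaces
        -- `e₂` inside the second graph, while only `e₁` is routed through the other side.
        ... | yes refl = x₁x₂ ◅◅ lift₂ (conn₂ x₂ y₂) ◅◅ Reachable-sym G y₁y₂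
        ... | no  ne   = edge-reachable G (∈-++ˡ⁺ e∈) (ends-inner₁ ne)
      from-x₁ : ∀ w → R (ι₁ x₁) w
      from-x₁ w with vertexView w
      ... | from₁ a = lift₁ (conn₁ x₁ a)
      ... | from₂ a = x₁x₂ ◅◅ lift₂ (conn₂ x₂ a)

    -- Degrees in the connection.

    private
      weight : Fin (n₁ + n₂) → Edge G → ℕ
      weight v e = ⟦ lookup (F₁ ++ F₂) e ⟧ * endCount v (ends G e)

      weight-↑ˡ : ∀ v {e p} → ends G (e ↑ˡ m₂) ≡ p → weight v (e ↑ˡ m₂) ≡ ⟦ lookup F₁ e ⟧ * endCount v p
      weight-↑ˡ v {e} eq = cong₂ (λ b p → ⟦ b ⟧ * endCount v p) (lookup-++ˡ F₁ F₂ e) eq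

      weight-↑ʳ : ∀ v {e p} → ends G (m₁ ↑ʳ e) ≡ p → weight v (m₁ ↑ʳ e) ≡ ⟦ lookup F₂ e ⟧ * endCount v p
      weight-↑ʳ v {e} eq = cong₂ (λ b p → ⟦ b ⟧ * endCount v p) (lookup-++ʳ F₁ F₂ e) eq

      δ₁₁ : ∀ u v → δ (ι₁ u) (ι₁ v) ≡ δ u v
      δ₁₁ = δ-injective ι₁ (↑ˡ-injective n₂ _ _)

      δ₂₂ : ∀ u v → δ (ι₂ u) (ι₂ v) ≡ δ u v
      δ₂₂ = δ-injective ι₂ (↑ʳ-injective n₁ _ _)

      δ₁₂ : ∀ u v → δ (ι₁ u) (ι₂ v) ≡ 0
      δ₁₂ u v = δ-≢ (ι₁≢ι₂ u v)

      δ₂₁ : ∀ u v → δ (ι₂ u) (ι₁ v) ≡ 0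
      δ₂₁ u v = δ-≢ (ι₁≢ι₂ v u ∘ sym)

      -- The order of the ends is irrelevant to the count; `y₂` comes first to match the summands of
      -- `at-e₂`.
      endCount-x₂y₂ : ∀ v → endCount v (ends G₂ e₂) ≡ δ v y₂ + δ v x₂
      endCount-x₂y₂ v =
        if-swap (λ (x , y) → endCount v (ends G₂ e₂) ≡ δ v y + δ v x) swapped (+-comm (δ v (proj₁ (ends G₂ e₂))) _) refl

    -- The contribution of `e₁` is split: the new edge at index `e₁` keeps the end `x₁`, and the one
    -- at index `e₂` supplies `y₁`. Agreement makes both present or both absent, so together they
    -- restore what `e₁` contributed. All other edges of the second graph contribute nothing.
    degree-ι₁ : lookup F₁ e₁ ≡ lookup F₂ e₂ → ∀ v → degree G (F₁ ++ F₂) (ι₁ v) ≡ degree G₁ F₁ v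
    degree-ι₁ agree v = begin
      degree G (F₁ ++ F₂) (ι₁ v)
        ≡⟨ degree-sum G (F₁ ++ F₂) (ι₁ v) ⟩
      sum (weight (ι₁ v))
        ≡⟨ sum-splitAt m₁ (weight (ι₁ v)) ⟩
      sum (weight (ι₁ v) ∘ (_↑ˡ m₂)) + sum (weight (ι₁ v) ∘ (m₁ ↑ʳ_))
        ≡⟨ cong (sum (weight (ι₁ v) ∘ (_↑ˡ m₂)) +_) (sum-single _ e₂ far) ⟩
      sum (weight (ι₁ v) ∘ (_↑ˡ m₂)) + weight (ι₁ v) (m₁ ↑ʳ e₂)
        ≡⟨ sum-cong-except _ _ e₁ near at-e₁ ⟨
      sum (λ e → ⟦ lookup F₁ e ⟧ * endCount v (ends G₁ e))
        ≡⟨ degree-sum G₁ F₁ v ⟨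
      degree G₁ F₁ v ∎
      where
      open ≡-Reasoning
      far : ∀ e → e ≢ e₂ → weight (ι₁ v) (m₁ ↑ʳ e) ≡ 0
      far e ne = trans (weight-↑ʳ (ι₁ v) (ends-inner₂ ne))
        (trans (cong (⟦ lookup F₂ e ⟧ *_) (cong₂ _+_ (δ₁₂ v _) (δ₁₂ v _))) (*-zeroʳ ⟦ lookup F₂ e ⟧))
      near : ∀ e → e ≢ e₁ → ⟦ lookup F₁ e ⟧ * endCount v (ends G₁ e) ≡ weight (ι₁ v) (e ↑ˡ m₂)
      near e ne = sym (trans (weight-↑ˡ (ι₁ v) (ends-inner₁ ne))
        (cong (⟦ lookup F₁ e ⟧ *_) (cong₂ _+_ (δ₁₁ v _) (δ₁₁ v _))))
      at-e₁ : ⟦ lookup F₁ e₁ ⟧ * endCount v (ends G₁ e₁) ≡ weight (ι₁ v) (e₁ ↑ˡ m₂) + weight (ι₁ v) (m₁ ↑ʳ e₂)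
      at-e₁ rewrite weight-↑ˡ (ι₁ v) ends-new₁ | weight-↑ʳ (ι₁ v) ends-new₂ | sym agree
                  | δ₁₁ v x₁ | δ₁₂ v x₂ | δ₁₁ v y₁ | δ₁₂ v y₂ | +-identityʳ (δ v x₁) | +-identityʳ (δ v y₁)
        = *-distribˡ-+ ⟦ lookup F₁ e₁ ⟧ (δ v x₁) (δ v y₁)

    degree-ι₂ : lookup F₁ e₁ ≡ lookup F₂ e₂ → ∀ v → degree G (F₁ ++ F₂) (ι₂ v) ≡ degree G₂ F₂ v
    degree-ι₂ agree v = begin
      degree G (F₁ ++ F₂) (ι₂ v)
        ≡⟨ degree-sum G (F₁ ++ F₂) (ι₂ v) ⟩
      sum (weight (ι₂ v))
        ≡⟨ sum-splitAt m₁ (weight (ι₂ v)) ⟩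
      sum (weight (ι₂ v) ∘ (_↑ˡ m₂)) + sum (weight (ι₂ v) ∘ (m₁ ↑ʳ_))
        ≡⟨ cong (_+ sum (weight (ι₂ v) ∘ (m₁ ↑ʳ_))) (sum-single _ e₁ far) ⟩
      weight (ι₂ v) (e₁ ↑ˡ m₂) + sum (weight (ι₂ v) ∘ (m₁ ↑ʳ_))
        ≡⟨ +-comm (weight (ι₂ v) (e₁ ↑ˡ m₂)) _ ⟩
      sum (weight (ι₂ v) ∘ (m₁ ↑ʳ_)) + weight (ι₂ v) (e₁ ↑ˡ m₂)
        ≡⟨ sum-cong-except _ _ e₂ near at-e₂ ⟨
      sum (λ e → ⟦ lookup F₂ e ⟧ * endCount v (ends G₂ e))
        ≡⟨ degree-sum G₂ F₂ v ⟨
      degree G₂ F₂ v ∎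
      where
      open ≡-Reasoning
      far : ∀ e → e ≢ e₁ → weight (ι₂ v) (e ↑ˡ m₂) ≡ 0
      far e ne = trans (weight-↑ˡ (ι₂ v) (ends-inner₁ ne))
        (trans (cong (⟦ lookup F₁ e ⟧ *_) (cong₂ _+_ (δ₂₁ v _) (δ₂₁ v _))) (*-zeroʳ ⟦ lookup F₁ e ⟧))
      near : ∀ e → e ≢ e₂ → ⟦ lookup F₂ e ⟧ * endCount v (ends G₂ e) ≡ weight (ι₂ v) (m₁ ↑ʳ e)
      near e ne = sym (trans (weight-↑ʳ (ι₂ v) (ends-inner₂ ne))
        (cong (⟦ lookup F₂ e ⟧ *_) (cong₂ _+_ (δ₂₂ v _) (δ₂₂ v _))))
      at-e₂ : ⟦ lookup F₂ e₂ ⟧ * endCount v (ends G₂ e₂) ≡ weight (ι₂ v) (m₁ ↑ʳ e₂) + weight (ι₂ v) (e₁ ↑ˡ m₂)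
      at-e₂ rewrite weight-↑ˡ (ι₂ v) ends-new₁ | weight-↑ʳ (ι₂ v) ends-new₂ | agree
                  | δ₂₁ v x₁ | δ₂₂ v x₂ | δ₂₁ v y₁ | δ₂₂ v y₂ | endCount-x₂y₂ v
        = *-distribˡ-+ ⟦ lookup F₂ e₂ ⟧ (δ v y₂) (δ v x₂)

    twoFactor⁺ : TwoFactor G₁ F₁ → TwoFactor G₂ F₂ → lookup F₁ e₁ ≡ lookup F₂ e₂ → TwoFactor G (F₁ ++ F₂)
    twoFactor⁺ tf₁ tf₂ agree v with vertexView v
    ... | from₁ w = trans (degree-ι₁ agree w) (tf₁ w)
    ... | from₂ w = trans (degree-ι₂ agree w) (tf₂ w)

    twoFactor⁻ : TwoFactor G (F₁ ++ F₂) → TwoFactor G₁ F₁ × TwoFactor G₂ F₂ × lookup F₁ e₁ ≡ lookup F₂ e₂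
    twoFactor⁻ tf =
      let agree = twoFactor⇒agree tf in
      (λ v → trans (sym (degree-ι₁ agree v)) (tf (ι₁ v))) , (λ v → trans (sym (degree-ι₂ agree v)) (tf (ι₂ v))) , agree

    hamiltonian⁺ : HasCycleThrough G₁ e₁ F₁ → HasCycleThrough G₂ e₂ F₂ → HamiltonianCycle G (F₁ ++ F₂)
    hamiltonian⁺ h₁@((tf₁ , _) , e₁∈) h₂@((tf₂ , _) , e₂∈) =
      twoFactor⁺ tf₁ tf₂ (trans ([]=⇒lookup e₁∈) (sym ([]=⇒lookup e₂∈))) , connected h₁ h₂

    -- Parity gives agreement, then connectivity puts `e₁` and hence `e₂` into the pair; only then
    -- can the images of the new edges under contraction be realised as walks.
    hamiltonian⁻ : HamiltonianCycle G (F₁ ++ F₂) → HasCycleThrough G₁ e₁ F₁ × HasCycleThrough G₂ e₂ F₂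
    hamiltonian⁻ (tf , conn) =
      let tf₁ , tf₂ , agree = twoFactor⁻ tf
          e₁∈ = connected⇒cut-edge∈ conn agree
          e₂∈ = lookup⇒[]= e₂ F₂ (trans (sym agree) ([]=⇒lookup e₁∈))
      in ((tf₁ , connected₁ conn e₁∈) , e₁∈) , ((tf₂ , connected₂ conn e₂∈) , e₂∈)

  split : ∀ (F : SpanningSubgraph G) → ∃ λ (F₁ : SpanningSubgraph G₁) → ∃ λ (F₂ : SpanningSubgraph G₂) → F ≡ F₁ ++ F₂
  split F = take m₁ F , drop m₁ F , sym (take++drop≡id m₁ F)

-- From the connection to conditions on the two graphs.

AgreeingFactorsHamiltonian : (G₁ : Graph) → Edge G₁ → (G₂ : Graph) → Edge G₂ → Set
AgreeingFactorsHamiltonian G₁ e₁ G₂ e₂ =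
  ∀ F₁ F₂ → TwoFactor G₁ F₁ → TwoFactor G₂ F₂ → lookup F₁ e₁ ≡ lookup F₂ e₂ →
  HasCycleThrough G₁ e₁ F₁ × HasCycleThrough G₂ e₂ F₂

-- Agreeing pairs of 2-factors are the 2-factors of the connection. The two cycles stand for its
-- Hamiltonicity, since the condition on pairs could hold vacuously.
twoFactorHamiltonian⇔ : ∀ G₁ e₁ G₂ e₂ swapped →
  TwoFactorHamiltonian (twoCutConnection G₁ e₁ G₂ e₂ swapped) ⇔
  (∃ (HasCycleThrough G₁ e₁) × ∃ (HasCycleThrough G₂ e₂) × AgreeingFactorsHamiltonian G₁ e₁ G₂ e₂)
twoFactorHamiltonian⇔ G₁ e₁ G₂ e₂ swapped = mk⇔ to from
  where
  open TwoCut G₁ e₁ G₂ e₂ swapped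
  to : TwoFactorHamiltonian G →
       ∃ (HasCycleThrough G₁ e₁) × ∃ (HasCycleThrough G₂ e₂) × AgreeingFactorsHamiltonian G₁ e₁ G₂ e₂
  to ((F , hc) , all) with F₁ , F₂ , refl ← split F =
    let h₁ , h₂ = hamiltonian⁻ F₁ F₂ hc in
    (F₁ , h₁) , (F₂ , h₂) , λ F₁ F₂ tf₁ tf₂ agree → hamiltonian⁻ F₁ F₂ (all _ (twoFactor⁺ F₁ F₂ tf₁ tf₂ agree))
  from : ∃ (HasCycleThrough G₁ e₁) × ∃ (HasCycleThrough G₂ e₂) × AgreeingFactorsHamiltonian G₁ e₁ G₂ e₂ →
         TwoFactorHamiltonian G
  from ((F₁ , h₁) , (F₂ , h₂) , agreeing) = (F₁ ++ F₂ , hamiltonian⁺ F₁ F₂ h₁ h₂) , all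
    where
    all : ∀ F → TwoFactor G F → HamiltonianCycle G F
    all F tf with F₁ , F₂ , refl ← split F =
      let tf₁ , tf₂ , agree = twoFactor⁻ F₁ F₂ tf
          h₁ , h₂ = agreeing F₁ F₂ tf₁ tf₂ agree
      in hamiltonian⁺ F₁ F₂ h₁ h₂

-- The middle clause keeps the last one from being vacuous: if all 2-factors of the first graph
-- contain `e₁` and none of the second contains `e₂`, the connection has no 2-factor at all.
OneSided : (G₁ : Graph) → Edge G₁ → (G₂ : Graph) → Edge G₂ → Set
OneSided G₁ e₁ G₂ e₂ =
    (∀ F → TwoFactor G₁ F → HamiltonianCycle G₁ F × e₁ ∈ F)
  × (∃ λ F → TwoFactor G₂ F × e₂ ∈ F)
  × (∀ F → TwoFactor G₂ F → e₂ ∈ F → HamiltonianCycle G₂ F)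

AgreeingFactorsHamiltonian-sym : ∀ G₁ e₁ G₂ e₂ →
  AgreeingFactorsHamiltonian G₁ e₁ G₂ e₂ → AgreeingFactorsHamiltonian G₂ e₂ G₁ e₁
AgreeingFactorsHamiltonian-sym _ _ _ _ agreeing F₂ F₁ tf₂ tf₁ agree = swap (agreeing F₁ F₂ tf₁ tf₂ (sym agree))

-- Each 2-factor to be tested contains its chosen edge, so it agrees with the fixed cycle through
-- the chosen edge of the other graph.
agreeing⇒oneSided : ∀ G₁ e₁ G₂ e₂ → ∃ (HasCycleThrough G₁ e₁) → ∃ (HasCycleThrough G₂ e₂) →
  AgreeingFactorsHamiltonian G₁ e₁ G₂ e₂ → (∀ F → TwoFactor G₁ F → e₁ ∈ F) → OneSided G₁ e₁ G₂ e₂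
agreeing⇒oneSided _ _ _ _ (F₁ , (tf₁ , _) , e₁∈F₁) (F₂ , (tf₂ , _) , e₂∈F₂) agreeing e₁∈ =
    (λ F tf → proj₁ (agreeing F F₂ tf tf₂ (both∈ (e₁∈ F tf) e₂∈F₂)))
  , (F₂ , tf₂ , e₂∈F₂)
  , (λ F tf e₂∈F → proj₁ (proj₂ (agreeing F₁ F tf₁ tf (both∈ e₁∈F₁ e₂∈F))))
  where
  both∈ : ∀ {m n} {F : Subset m} {F′ : Subset n} {e e′} → e ∈ F → e′ ∈ F′ → lookup F e ≡ lookup F′ e′
  both∈ e∈ e′∈ = trans ([]=⇒lookup e∈) (sym ([]=⇒lookup e′∈))

-- The first clause puts `e₁` in `F₁`, agreement carries this over to `e₂ ∈ F₂`, and the last clause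
-- then applies.
oneSided⇒agreeing : ∀ G₁ e₁ G₂ e₂ → OneSided G₁ e₁ G₂ e₂ → AgreeingFactorsHamiltonian G₁ e₁ G₂ e₂
oneSided⇒agreeing _ _ _ _ (all₁ , _ , all₂) F₁ F₂ tf₁ tf₂ agree =
  let h₁ = all₁ F₁ tf₁
      e₂∈ = lookup⇒[]= _ F₂ (trans (sym agree) ([]=⇒lookup (proj₂ h₁)))
  in h₁ , (all₂ F₂ tf₂ e₂∈ , e₂∈)

oneSided⇒cycles : ∀ G₁ e₁ G₂ e₂ → Hamiltonian G₁ → OneSided G₁ e₁ G₂ e₂ →
  ∃ (HasCycleThrough G₁ e₁) × ∃ (HasCycleThrough G₂ e₂)
oneSided⇒cycles _ _ _ _ (F₁ , tf₁ , _) (all₁ , (F₂ , tf₂ , e₂∈) , all₂) =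
  (F₁ , all₁ F₁ tf₁) , (F₂ , all₂ F₂ tf₂ e₂∈ , e₂∈)

agreeing⇒oneSided⊎oneSided : ∀ G₁ e₁ G₂ e₂ → ∃ (HasCycleThrough G₁ e₁) → ∃ (HasCycleThrough G₂ e₂) →
  AgreeingFactorsHamiltonian G₁ e₁ G₂ e₂ → OneSided G₁ e₁ G₂ e₂ ⊎ OneSided G₂ e₂ G₁ e₁
agreeing⇒oneSided⊎oneSided G₁ e₁ G₂ e₂ c₁ c₂ agreeing
  -- Choosing the disjunct constructively takes a finite search for a 2-factor of `G₁` avoiding
  -- `e₁`.
  with anySubset? (λ F → all? (λ v → degree G₁ F v ℕ.≟ 2) ×-dec ¬? (e₁ ∈? F))
... | no  none = inj₁ (agreeing⇒oneSided G₁ e₁ G₂ e₂ c₁ c₂ agreeing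
        λ F tf → decidable-stable (e₁ ∈? F) λ e₁∉ → none (F , tf , e₁∉))
... | yes (F₁ , tf₁ , e₁∉) = inj₂ (agreeing⇒oneSided G₂ e₂ G₁ e₁ c₂ c₁ (AgreeingFactorsHamiltonian-sym G₁ e₁ G₂ e₂ agreeing)
        -- A 2-factor avoiding `e₂` would agree with the `F₁` just found, and the condition on pairs
        -- would force `e₁ ∈ F₁`.
        λ F tf → decidable-stable (e₂ ∈? F) λ e₂∉ →
          e₁∉ (proj₂ (proj₁ (agreeing F₁ F tf₁ tf (trans (∉⇒lookup e₁∉) (sym (∉⇒lookup e₂∉)))))))

theorem4p2 : (G₁ G₂ : Graph) → Connected G₁ → Connected G₂ →
    Hamiltonian G₁ → Hamiltonian G₂ →
    (e₁ : Edge G₁) (e₂ : Edge G₂) (swapped : Bool) →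
    TwoFactorHamiltonian (twoCutConnection G₁ e₁ G₂ e₂ swapped)
    ⇔
    ( ( (∀ F → TwoFactor G₁ F → HamiltonianCycle G₁ F × e₁ ∈ F)
    × (∃ λ F → TwoFactor G₂ F × e₂ ∈ F)
    × (∀ F → TwoFactor G₂ F → e₂ ∈ F → HamiltonianCycle G₂ F) )
    ⊎ ( (∀ F → TwoFactor G₂ F → HamiltonianCycle G₂ F × e₂ ∈ F)
    × (∃ λ F → TwoFactor G₁ F × e₁ ∈ F)
    × (∀ F → TwoFactor G₁ F → e₁ ∈ F → HamiltonianCycle G₁ F) ) )
theorem4p2 G₁ G₂ _ _ ham₁ ham₂ e₁ e₂ swapped = mk⇔
  (λ tfh → let c₁ , c₂ , agreeing = to tfh in agreeing⇒oneSided⊎oneSided G₁ e₁ G₂ e₂ c₁ c₂ agreeing)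
  λ { (inj₁ one) → let c₁ , c₂ = oneSided⇒cycles G₁ e₁ G₂ e₂ ham₁ one in
        from (c₁ , c₂ , oneSided⇒agreeing G₁ e₁ G₂ e₂ one)
    -- Symmetry is applied to the condition on pairs, so the connection of the graphs in the
    -- opposite order never appears.
    ; (inj₂ one) → let c₂ , c₁ = oneSided⇒cycles G₂ e₂ G₁ e₁ ham₂ one in
        from (c₁ , c₂ , AgreeingFactorsHamiltonian-sym G₂ e₂ G₁ e₁ (oneSided⇒agreeing G₂ e₂ G₁ e₁ one)) }
  where open Equivalence (twoFactorHamiltonian⇔ G₁ e₁ G₂ e₂ swapped)
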